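{- If $G$ is a connected bipartite graph, then $\mathrm{vp}(G) \leq \alpha(G)$.
   Context: All graphs are finite, undirected and simple. $\alpha(G)$ denotes the independence number of $G$. A $u,v$-geodesic is a shortest $u,v$-path. For a vertex $x$ of $G$, a set $S \subseteq V(G)$ is an $x$-position set if for every $y \in S$ no vertex of $S \setminus \{y\}$ lies on any $x,y$-geodesic in $G$. The $x$-position number $p_x(G)$ is the maximum cardinality of an $x$-position set of $G$. Define $\mathrm{vp}(G) = \max_{x \in V(G)} p_x(G)$. -}

module Defs where

open import Data.Fin.Base using (Fin; zero; suc)
open import Data.Fin.Properties using (_≟_; all?; injective⇒≤)
open import Data.Fin.Subset using (Subset; inside; outside; _∈_; _-_; ∁; ∣_∣)
open import Data.Fin.Subset.Properties using (_∈?_)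
open import Data.List.Base
  using (List; []; _∷_; [_]; _++_; map; filter; head; last; length; lookup; allFin)
open import Data.List.Extrema.Nat using (max)
import Data.List.Membership.Propositional as List
open import Data.List.Membership.Propositional.Properties using (∈-lookup)
import Data.List.Membership.DecPropositional as DecList
import Data.List.Relation.Unary.All as All
open import Data.List.Relation.Unary.AllPairs using (_∷_)
open import Data.List.Relation.Unary.Linked using (Linked; linked?)
open import Data.List.Relation.Unary.Unique.Propositional using (Unique)
open import Data.List.Relation.Unary.Unique.DecPropositional using (unique?)
open import Data.Maybe.Base using (just)
import Data.Maybe.Properties as Maybe
open import Data.Nat.Base using (ℕ; zero; suc; _≤_; z≤n; s≤s)
import Data.Nat.Properties as ℕ
open import Data.Product.Base using (∃-syntax; _×_; _,_)
open import Data.Vec.Base using ([]; _∷_)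
open import Level using (0ℓ)
open import Relation.Binary using (Rel; Symmetric; Irreflexive)
import Relation.Binary as B
open import Relation.Binary.PropositionalEquality using (_≡_; refl; sym; cong)
open import Relation.Nullary
  using (¬_; contradiction; Dec; ¬?; map′; _×-dec_; _→-dec_)
open import Relation.Unary using (Pred; Decidable)

-- Decidable adjacency makes the invariants below computable functions; it is
-- automatic classically.
record Graph (n : ℕ) : Set₁ where
  field
    Adj        : Rel (Fin n) 0ℓ
    adj?       : B.Decidable Adj
    adj-sym    : Symmetric Adj
    adj-irrefl : Irreflexive _≡_ Adj

subsets : ∀ n → List (Subset n)
subsets zero    = [ [] ]
subsets (suc n) = map (outside ∷_) (subsets n) ++ map (inside ∷_) (subsets n)

-- The first argument of max is the value for the empty list. It is harmless
-- here whenever ∅ satisfies P, as it does for both uses below.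
maxCard : ∀ {n} {P : Pred (Subset n) 0ℓ} → Decidable P → ℕ
maxCard {n} P? = max 0 (map ∣_∣ (filter P? (subsets n)))

allLists? : ∀ {n} k {Q : Pred (List (Fin n)) 0ℓ} → Decidable Q →
            Dec (∀ vs → length vs ≤ k → Q vs)
allLists? zero Q? =
  map′ (λ { q [] _ → q }) (λ f → f [] z≤n) (Q? [])
allLists? (suc k) Q? =
  map′ (λ { (q , _) [] _ → q ; (_ , f) (v ∷ vs) (s≤s le) → f v vs le })
       (λ f → f [] z≤n , λ v vs le → f (v ∷ vs) (s≤s le))
       (Q? [] ×-dec all? (λ v → allLists? k (λ vs → Q? (v ∷ vs))))

lookup-injective : ∀ {n} {vs : List (Fin n)} → Unique vs → ∀ i j →
                   lookup vs i ≡ lookup vs j → i ≡ j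
lookup-injective (_ ∷ _) zero zero _ = refl
lookup-injective {vs = _ ∷ vs} (v≢ ∷ _) zero (suc j) eq =
  contradiction eq (All.lookup v≢ (∈-lookup {xs = vs} j))
lookup-injective {vs = _ ∷ vs} (v≢ ∷ _) (suc i) zero eq =
  contradiction (sym eq) (All.lookup v≢ (∈-lookup {xs = vs} i))
lookup-injective (_ ∷ u) (suc i) (suc j) eq =
  cong suc (lookup-injective u i j eq)

unique⇒length≤ : ∀ {n} {vs : List (Fin n)} → Unique vs → length vs ≤ n
unique⇒length≤ u = injective⇒≤ (λ {i} {j} → lookup-injective u i j)

module _ {n : ℕ} (G : Graph n) where
  open Graph G using (Adj; adj?)

  IsIndependent : Pred (Subset n) 0ℓ
  IsIndependent S = ∀ u → u ∈ S → ∀ v → v ∈ S → ¬ Adj u v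

  -- A path is represented by the list of its vertices in order.
  IsPath : Fin n → Fin n → Pred (List (Fin n)) 0ℓ
  IsPath u v vs =
    head vs ≡ just u × last vs ≡ just v × Linked Adj vs × Unique vs

  -- The list of vertices is one longer than the path, so comparing numbers of
  -- vertices is comparing lengths.
  IsGeodesic : Fin n → Fin n → Pred (List (Fin n)) 0ℓ
  IsGeodesic u v vs =
    IsPath u v vs × (∀ ws → IsPath u v ws → length vs ≤ length ws)

  IsPositionSet : Fin n → Pred (Subset n) 0ℓ
  IsPositionSet x S =
    ∀ y → y ∈ S → ∀ z → z ∈ S - y → ∀ vs → IsGeodesic x y vs → ¬ z List.∈ vs

  Connected : Set
  Connected = ∀ u v → ∃[ vs ] IsPath u v vs

  -- The two parts are A and its complement; either may be empty.
  Bipartite : Set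
  Bipartite = ∃[ A ] IsIndependent A × IsIndependent (∁ A)

  isIndependent? : Decidable IsIndependent
  isIndependent? S =
    all? λ u → (u ∈? S) →-dec all? λ v → (v ∈? S) →-dec ¬? (adj? u v)

  isPath? : ∀ u v → Decidable (IsPath u v)
  isPath? u v vs =
    Maybe.≡-dec _≟_ (head vs) (just u) ×-dec
    Maybe.≡-dec _≟_ (last vs) (just v) ×-dec
    linked? adj? vs ×-dec unique? _≟_ vs

  allPaths? : ∀ u v {Q : Pred (List (Fin n)) 0ℓ} → Decidable Q →
              Dec (∀ vs → IsPath u v vs → Q vs)
  allPaths? u v Q? =
    map′ (λ { f vs p@(_ , _ , _ , un) → f vs (unique⇒length≤ un) p })
         (λ f vs _ → f vs)
         (allLists? n (λ vs → isPath? u v vs →-dec Q? vs))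

  isGeodesic? : ∀ u v → Decidable (IsGeodesic u v)
  isGeodesic? u v vs =
    isPath? u v vs ×-dec allPaths? u v (λ ws → length vs ℕ.≤? length ws)

  isPositionSet? : ∀ x → Decidable (IsPositionSet x)
  isPositionSet? x S =
    all? λ y → (y ∈? S) →-dec
    all? λ z → (z ∈? S - y) →-dec
    map′ (λ { f vs g@(p , _) → f vs p g }) (λ f vs _ → f vs)
      (allPaths? x y λ vs → isGeodesic? x y vs →-dec ¬? (DecList._∈?_ _≟_ z vs))

  α : ℕ
  α = maxCard isIndependent?

  positionNumber : Fin n → ℕ
  positionNumber x = maxCard (isPositionSet? x)

  -- The default 0 is attained only by the graph of order 0.
  vp : ℕ
  vp = max 0 (map positionNumber (allFin n))

-- In a connected bipartite graph every x-position set S is independent, which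
-- gives vp ≤ α. Suppose u, v ∈ S are adjacent. By two-colouring, geodesics from
-- x to u and from x to v have lengths of different parity, so one of them, say
-- the one to u, is shorter. Extended by the edge uv it becomes an x,v-geodesic
-- through u, contradicting u, v ∈ S.
{-# OPTIONS --safe #-}
module Submission where

open import Defs
open import Data.Bool.Base using (Bool; not)
open import Data.Bool.Properties using (¬-not; not-¬)
open import Data.Fin.Base using (Fin)
open import Data.Fin.Subset using (Subset; inside; outside; _∈_; ∁; ∣_∣)
open import Data.Fin.Subset.Properties using (x∉p⇒x∈∁p; x∈p∧x≢y⇒x∈p-y)
open import Data.List.Base
  using (List; []; _∷_; [_]; _++_; _∷ʳ_; map; filter; head; last; length; allFin)
open import Data.List.Extrema.Nat using (max≤v⁺; max-mono-⊆)
import Data.List.Membership.Propositional as List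
open import Data.List.Membership.Propositional.Properties using (∈-∃++; ∈-++⁺ˡ)
open import Data.List.Properties using (length-++; ++-assoc)
open import Data.List.Relation.Binary.Subset.Propositional.Properties
  using (map⁺; filter⁺′; ⊆-refl)
open import Data.List.Relation.Unary.All as All using ([]; _∷_)
import Data.List.Relation.Unary.All.Properties as All
open import Data.List.Relation.Unary.AllPairs using ([]; _∷_)
open import Data.List.Relation.Unary.Any using (here; there)
open import Data.List.Relation.Unary.Linked using (Linked; []; [-]; _∷_)
import Data.List.Relation.Unary.Linked.Properties as Linked
open import Data.List.Relation.Unary.Unique.Propositional using (Unique)
import Data.List.Relation.Unary.Unique.Propositional.Properties as Unique
open import Data.Maybe.Base using (just)
open import Data.Maybe.Relation.Binary.Connected as Maybe using (just)
open import Data.Nat using (ℕ; suc; _≤_; _<_; z≤n)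
open import Data.Nat.Induction using (<-wellFounded)
open import Data.Nat.Properties
  using (≤-trans; <⇒≱; ≮⇒≥; _<?_; <-cmp; suc-injective; m≤m+n; +-comm)
open import Data.Product.Base using (∃-syntax; _×_; _,_; proj₁; proj₂)
open import Data.Vec.Base using (lookup)
open import Data.Vec.Properties using ([]=⇒lookup; lookup⇒[]=)
open import Induction.WellFounded using (Acc; acc)
open import Level using (Level; 0ℓ)
open import Relation.Binary using (Rel; tri<; tri≈; tri>)
open import Relation.Binary.PropositionalEquality
  using (_≡_; _≢_; refl; sym; trans; cong; subst)
open import Relation.Nullary using (¬_; contradiction; yes; no)
open import Relation.Unary using (Pred; Decidable) renaming (_⊆_ to _⇒_)

private
  variable
    a ℓ : Level
    A : Set a
    n : ℕ

last-∷ʳ : ∀ (xs : List A) x → last (xs ∷ʳ x) ≡ just x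
last-∷ʳ []           x = refl
last-∷ʳ (_ ∷ [])     x = refl
last-∷ʳ (_ ∷ y ∷ xs) x = last-∷ʳ (y ∷ xs) x

head-++ : ∀ (xs : List A) {ys x} → head xs ≡ just x → head (xs ++ ys) ≡ just x
head-++ (_ ∷ _) eq = eq

head-∷ʳ-++ : ∀ (xs : List A) {x ys} → head (xs ∷ʳ x) ≡ head (xs ++ x ∷ ys)
head-∷ʳ-++ []      = refl
head-∷ʳ-++ (_ ∷ _) = refl

last⇒∈ : ∀ (xs : List A) {x} → last xs ≡ just x → x List.∈ xs
last⇒∈ (_ ∷ [])     refl = here refl
last⇒∈ (_ ∷ y ∷ xs) eq   = there (last⇒∈ (y ∷ xs) eq)

length-∷ʳ : ∀ (xs : List A) x → length (xs ∷ʳ x) ≡ suc (length xs)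
length-∷ʳ xs x = trans (length-++ xs) (+-comm (length xs) 1)

Linked-++⁻ˡ : ∀ {R : Rel A ℓ} xs {ys} → Linked R (xs ++ ys) → Linked R xs
Linked-++⁻ˡ []           _       = []
Linked-++⁻ˡ (_ ∷ [])     _       = [-]
Linked-++⁻ˡ (_ ∷ y ∷ xs) (r ∷ l) = r ∷ Linked-++⁻ˡ (y ∷ xs) l

Unique-++⁻ˡ : ∀ (xs : List A) {ys} → Unique (xs ++ ys) → Unique xs
Unique-++⁻ˡ []       _        = []
Unique-++⁻ˡ (_ ∷ xs) (x≢ ∷ u) = All.++⁻ˡ xs x≢ ∷ Unique-++⁻ˡ xs u

-- Every subset that passes the filter for `P?` passes the one for `Q?`, and both maxima share the
-- default 0.
maxCard-mono : ∀ {P Q : Pred (Subset n) 0ℓ} (P? : Decidable P) (Q? : Decidable Q) →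
               P ⇒ Q → maxCard P? ≤ maxCard Q?
maxCard-mono {n} P? Q? P⇒Q =
  max-mono-⊆ {xs = map ∣_∣ (filter P? (subsets n))} {map ∣_∣ (filter Q? (subsets n))}
    z≤n (map⁺ ∣_∣ (filter⁺′ P? Q? P⇒Q {subsets n} ⊆-refl))

module _ (G : Graph n) where
  open Graph G using (Adj; adj-sym; adj-irrefl)

  -- Cutting the path just after `v` leaves it linked and free of repetitions.
  path-prefix : ∀ {x u v vs} → IsPath G x u vs → v List.∈ vs →
                ∃[ ws ] IsPath G x v ws × length ws ≤ length vs
  path-prefix {v = v} (h , _ , l , un) v∈vs with ∈-∃++ v∈vs
  ... | as , bs , refl =
    as ∷ʳ v
    , ( trans (head-∷ʳ-++ as) h
      , last-∷ʳ as v
      , Linked-++⁻ˡ (as ∷ʳ v) (subst (Linked Adj) split l)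
      , Unique-++⁻ˡ (as ∷ʳ v) (subst Unique split un))
    , subst (length (as ∷ʳ v) ≤_)
        (sym (trans (cong length split) (length-++ (as ∷ʳ v)))) (m≤m+n _ _)
    where
    split : as ++ v ∷ bs ≡ (as ∷ʳ v) ++ bs
    split = sym (++-assoc as [ v ] bs)

  path-∷ʳ : ∀ {x u v vs} → IsPath G x u vs → Adj u v → ¬ v List.∈ vs →
            IsPath G x v (vs ∷ʳ v)
  path-∷ʳ {v = v} {vs} (h , la , l , un) uv v∉vs =
      head-++ vs h
    , last-∷ʳ vs v
    , Linked.++⁺ l (subst (λ m → Maybe.Connected Adj m (just v)) (sym la) (just uv)) [-]
    , Unique.++⁺ un ([] ∷ []) λ { (v∈vs , here refl) → v∉vs v∈vs }

  -- Stated negatively so that no search for a minimal path is needed.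
  ¬¬geodesic : ∀ {x u vs} → IsPath G x u vs → ¬ (∀ ws → ¬ IsGeodesic G x u ws)
  ¬¬geodesic {x} {u} p none = noPath (<-wellFounded _) p
    where
    noPath : ∀ {vs} → Acc _<_ (length vs) → ¬ IsPath G x u vs
    noPath {vs} (acc rs) p = none vs (p , minimal)
      where
      minimal : ∀ ws → IsPath G x u ws → length vs ≤ length ws
      minimal ws q with length ws <? length vs
      ... | yes ws<vs = contradiction q (noPath (rs ws<vs))
      ... | no  ws≮vs = ≮⇒≥ ws≮vs

  -- The extension has `suc (length vs)` vertices, which is at most `length ws`, the least number on
  -- any path from `x` to `v`.
  geodesic-∷ʳ : ∀ {x u v vs ws} → IsPath G x u vs → Adj u v →
                IsGeodesic G x v ws → length vs < length ws →
                IsGeodesic G x v (vs ∷ʳ v)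
  geodesic-∷ʳ {v = v} {vs} p uv (_ , minimal) vs<ws =
    path-∷ʳ p uv v∉vs ,
    λ ws′ q → subst (_≤ length ws′) (sym (length-∷ʳ vs v)) (≤-trans vs<ws (minimal ws′ q))
    where
    v∉vs : ¬ v List.∈ vs
    -- If `v` were on `vs`, the prefix ending at `v` would be a path shorter than the geodesic `ws`.
    v∉vs v∈vs with path-prefix p v∈vs
    ... | us , q , us≤vs = <⇒≱ vs<ws (≤-trans (minimal us q) us≤vs)

  -- A `Subset` is a vector of Booleans, so looking up a vertex in the part `A` already gives a
  -- two-colouring.
  colour : Bipartite G → ∃[ c ] (∀ {u v} → Adj u v → c u ≡ not (c v))
  colour (A , indA , ind∁A) = lookup A , λ {u} {v} uv → ¬-not (distinct uv)
    where
    outside⇒∈∁ : ∀ {u} → lookup A u ≡ outside → u ∈ ∁ A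
    outside⇒∈∁ {u} eq = x∉p⇒x∈∁p λ u∈A →
      contradiction (trans (sym ([]=⇒lookup u∈A)) eq) λ ()
    distinct : ∀ {u v} → Adj u v → lookup A u ≢ lookup A v
    distinct {u} {v} uv eq with lookup A v in eqv
    ... | inside  = indA u (lookup⇒[]= u A eq) v (lookup⇒[]= v A eqv) uv
    ... | outside = ind∁A u (outside⇒∈∁ eq) v (outside⇒∈∁ eqv) uv

  module _ {c : Fin n → Bool} (proper : ∀ {u v} → Adj u v → c u ≡ not (c v)) where

    -- The colour flips at every edge, so walking both lists in step keeps the current colours
    -- equal; this replaces any arithmetic of parities. The starts `x` and `y` may differ because
    -- the walks can separate after one step.
    endpoint-colour : ∀ {x y u v} vs ws →
      Linked Adj (x ∷ vs) → Linked Adj (y ∷ ws) → c x ≡ c y →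
      length vs ≡ length ws → last (x ∷ vs) ≡ just u → last (y ∷ ws) ≡ just v →
      c u ≡ c v
    endpoint-colour [] [] _ _ eq _ refl refl = eq
    endpoint-colour (_ ∷ vs) (_ ∷ ws) (xx′ ∷ l) (yy′ ∷ m) eq len lu lv =
      endpoint-colour vs ws l m
        -- Reversing each edge lets `proper` express the colour of its second end through that of
        -- its first.
        (trans (proper (adj-sym xx′)) (trans (cong not eq) (sym (proper (adj-sym yy′)))))
        (suc-injective len) lu lv

    adjacent⇒lengths≢ : ∀ {x u v vs ws} → IsPath G x u vs → IsPath G x v ws →
                        Adj u v → length vs ≢ length ws
    adjacent⇒lengths≢ {vs = _ ∷ vs} {_ ∷ ws} (refl , lu , l , _) (refl , lv , m , _) uv len =
      not-¬ (endpoint-colour vs ws l m refl (suc-injective len) lu lv) (proper uv)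

  -- Otherwise `vs ∷ʳ v` would be a geodesic to `v` through `u`, and `u` lies in `S - v` because
  -- adjacent vertices are distinct.
  no-shorter-neighbour : ∀ {x S u v vs ws} → IsPositionSet G x S → u ∈ S → v ∈ S →
    Adj u v → IsPath G x u vs → IsGeodesic G x v ws → ¬ length vs < length ws
  no-shorter-neighbour {u = u} {v} {vs} pos u∈S v∈S uv p q vs<ws =
    pos v v∈S u (x∈p∧x≢y⇒x∈p-y u∈S λ u≡v → adj-irrefl u≡v uv)
      (vs ∷ʳ v) (geodesic-∷ʳ p uv q vs<ws) (∈-++⁺ˡ (last⇒∈ vs (proj₁ (proj₂ p))))

  positionSet⇒independent : Connected G → Bipartite G → ∀ {x S} →
                            IsPositionSet G x S → IsIndependent G S
  positionSet⇒independent conn bip {x} pos u u∈S v v∈S uv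
    with colour bip | conn x u | conn x v
  ... | _ , proper | _ , p₀ | _ , q₀ =
    -- The goal is a contradiction, so the doubly negated existence of geodesics suffices to take
    -- one to each of `u` and `v`.
    ¬¬geodesic p₀ λ vs p → ¬¬geodesic q₀ λ ws q → compare vs p ws q
    where
    compare : ∀ vs → IsGeodesic G x u vs → ∀ ws → ¬ IsGeodesic G x v ws
    compare vs p ws q with <-cmp (length vs) (length ws)
    ... | tri< vs<ws _ _ = no-shorter-neighbour pos u∈S v∈S uv (proj₁ p) q vs<ws
    ... | tri≈ _ vs≡ws _ = adjacent⇒lengths≢ proper (proj₁ p) (proj₁ q) uv vs≡ws
    ... | tri> _ _ ws<vs =
      no-shorter-neighbour pos v∈S u∈S (adj-sym uv) (proj₁ q) p ws<vs

theorem3p2 : ∀ {n : ℕ} (G : Graph n) → Connected G → Bipartite G → vp G ≤ α G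
-- `z≤n` handles the default value of the maximum, `bound` each vertex.
theorem3p2 {n} G conn bip = max≤v⁺ z≤n (All.map⁺ (All.universal bound (allFin n)))
  where
  bound : ∀ x → positionNumber G x ≤ α G
  bound x = maxCard-mono (isPositionSet? G x) (isIndependent? G)
              (positionSet⇒independent G conn bip)
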